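{- Let $p>2$ be a non-palindromic prime and write $$p=\sum_{n=0}^{t-1}s_n2^n,\quad s_0=s_{t-1}=1,\ s_1,\ldots,s_{t-2}\in\{0,1\}.$$ Let $q=\sum_{n=0}^{t-1}s_{t-1-n}2^n$ be the reverse of $p$, and let $T$ be a positive integer with $$T\equiv 0 \bmod \mathrm{ord}_q(2)\quad\mbox{and}\quad T\not\equiv 0\bmod \mathrm{ord}_p(2).$$ Then the $T$-periodic binary sequence $\mathcal{S}$ with initial vector $$\mathcal{S}_T=(s_0,s_1,\ldots,s_{t-1},0,0,\ldots,0)$$ (of length $T$) satisfies $$\lambda(\mathcal{S})=\lambda^{sym}(\mathcal{S})+\log_2(q)=\log_2(2^T-1).$$
   Context: A binary sequence $\mathcal{S}=(s_n)_{n=0}^\infty$, $s_n\in\{0,1\}$, is $T$-periodic if $s_{n+T}=s_n$ for all $n\ge 0$ ($T$ need not be the least period); it is determined by its initial vector $\mathcal{S}_T=(s_0,\ldots,s_{T-1})$. Put $S_T(x)=\sum_{n=0}^{T-1}s_nx^n$. The 2-adic complexity of $\mathcal{S}$ (with respect to the period $T$) is $$\lambda(\mathcal{S})=\log_2\left(\frac{2^T-1}{\gcd(2^T-1,S_T(2))}\right).$$ The reverse sequence $\mathcal{S}^{rev}$ is the $T$-periodic sequence with initial vector $(s_{T-1},s_{T-2},\ldots,s_0)$, and the symmetric 2-adic complexity is $\lambda^{sym}(\mathcal{S})=\min\{\lambda(\mathcal{S}),\lambda(\mathcal{S}^{rev})\}$. An odd integer $p=\sum_{n=0}^{t-1}s_n2^n$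 with $s_0=s_{t-1}=1$ and $s_n\in\{0,1\}$ is called palindromic if it equals its reverse $q=\sum_{n=0}^{t-1}s_{t-1-n}2^n$. For an odd integer $m>1$, $\mathrm{ord}_m(2)$ denotes the order of $2$ modulo $m$, i.e. the smallest positive integer $o$ with $2^o\equiv 1\bmod m$. -}

module Defs where

open import Data.Nat.Base as ℕ using (ℕ; zero; suc; NonZero; _^_; _∸_; s≤s; z≤n)
import Data.Nat.Properties as ℕₚ
open import Data.Nat.Divisibility using (_∣_)
open import Data.Nat.DivMod using (_/_; _mod_)
open import Data.Nat.GCD using (gcd; gcd[m,n]≢0)
open import Data.Nat.Induction using (<-rec)
open import Data.Nat.Logarithm
  using (⌊log₂_⌋; ⌊log₂⌋-mono-≤; ⌊log₂[2^n]⌋≡n; ⌊log₂⌊n/2⌋⌋≡⌊log₂n⌋∸1)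
import Data.Nat.Solver as ℕ-Solver
open import Data.Integer.Base as ℤ using (+_)
import Data.Integer.Properties as ℤₚ
import Data.Integer.Solver as ℤ-Solver
open import Data.Rational.Unnormalised.Base as ℚ
  using (ℚᵘ; mkℚᵘ; *≤*; *≡*; ∣_∣; _⊓_) renaming (_≤_ to _≤ᵘ_; _≃_ to _≃ᵘ_)
import Data.Rational.Unnormalised.Properties as ℚₚ
open import Data.Rational.Unnormalised.Solver using (module +-*-Solver)
open import Data.Fin.Base using (Fin; toℕ)
open import Data.Vec.Base using (Vec; []; _∷_; lookup; tabulate; reverse; sum)
open import Data.Product.Base using (_×_)
open import Data.Sum.Base using (inj₁; inj₂)
open import Function.Base using (_∘_)
open import Relation.Binary.PropositionalEquality
  using (_≡_; _≢_; refl; sym; cong; subst; subst₂)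

-- Real numbers (Bishop's regular sequences).  Sequences are indexed from
-- zero, so the k-th term is an approximation with error at most 1/(k+1).

1/1+_ : ℕ → ℚᵘ
1/1+ k = mkℚᵘ (+ 1) k

record ℝ : Set where
  field
    seq     : ℕ → ℚᵘ
    regular : ∀ m n → ∣ seq m ℚ.- seq n ∣ ≤ᵘ (1/1+ m) ℚ.+ (1/1+ n)

open ℝ public

infix 4 _≈_
_≈_ : ℝ → ℝ → Set
x ≈ y = ∀ n → ∣ seq x n ℚ.- seq y n ∣ ≤ᵘ mkℚᵘ (+ 2) n

∣x-y∣≤b : ∀ x y b → x ≤ᵘ y ℚ.+ b → y ≤ᵘ x ℚ.+ b → ∣ x ℚ.- y ∣ ≤ᵘ b
∣x-y∣≤b x y b x≤ y≤ with ℚₚ.∣p∣≡p∨∣p∣≡-p (x ℚ.- y)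
... | inj₁ eq rewrite eq = begin
  x ℚ.- y           ≤⟨ ℚₚ.+-monoˡ-≤ (ℚ.- y) x≤ ⟩
  (y ℚ.+ b) ℚ.- y   ≃⟨ solve 2 (λ y b → (y :+ b) :- y := b) ℚₚ.≃-refl y b ⟩
  b                 ∎
  where
  open ℚₚ.≤-Reasoning
  open +-*-Solver
... | inj₂ eq rewrite eq = begin
  ℚ.- (x ℚ.- y)     ≃⟨ solve 2 (λ x y → :- (x :- y) := y :- x) ℚₚ.≃-refl x y ⟩
  y ℚ.- x           ≤⟨ ℚₚ.+-monoˡ-≤ (ℚ.- x) y≤ ⟩
  (x ℚ.+ b) ℚ.- x   ≃⟨ solve 2 (λ y b → (y :+ b) :- y := b) ℚₚ.≃-refl x b ⟩
  b                 ∎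
  where
  open ℚₚ.≤-Reasoning
  open +-*-Solver

p≤∣p∣ : ∀ p → p ≤ᵘ ∣ p ∣
p≤∣p∣ (mkℚᵘ (+ n) d)        = ℚₚ.≤-refl
p≤∣p∣ (mkℚᵘ ℤ.-[1+ n ] d)   = *≤* ℤ.-≤+

x≤y+b : ∀ x y b → ∣ x ℚ.- y ∣ ≤ᵘ b → x ≤ᵘ y ℚ.+ b
x≤y+b x y b h = begin
  x                      ≃⟨ solve 2 (λ x y → x := y :+ (x :- y)) ℚₚ.≃-refl x y ⟩
  y ℚ.+ (x ℚ.- y)        ≤⟨ ℚₚ.+-monoʳ-≤ y (ℚₚ.≤-trans (p≤∣p∣ (x ℚ.- y)) h) ⟩
  y ℚ.+ b                ∎
  where
  open ℚₚ.≤-Reasoning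
  open +-*-Solver

-- The bound in `regular` is symmetric, so one-sided estimates suffice.
regular-from : (f : ℕ → ℚᵘ) →
  (∀ m n → f m ≤ᵘ f n ℚ.+ ((1/1+ m) ℚ.+ (1/1+ n))) →
  ∀ m n → ∣ f m ℚ.- f n ∣ ≤ᵘ (1/1+ m) ℚ.+ (1/1+ n)
regular-from f h m n = ∣x-y∣≤b (f m) (f n) _ (h m n)
  (ℚₚ.≤-trans (h n m) (ℚₚ.≤-reflexive (ℚₚ.+-congʳ (f m) (ℚₚ.+-comm (1/1+ n) (1/1+ m)))))

regular-≤ : ∀ x m n → seq x m ≤ᵘ seq x n ℚ.+ ((1/1+ m) ℚ.+ (1/1+ n))
regular-≤ x m n = x≤y+b (seq x m) (seq x n) _ (regular x m n)

-- double k + 1 = 2 (k + 1)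
double : ℕ → ℕ
double k = suc (k ℕ.+ k)

halves : ∀ k → (1/1+ double k) ℚ.+ (1/1+ double k) ≃ᵘ (1/1+ k)
halves k = *≡* (cong +_ (lemma k))
  where
  open ℕ-Solver.+-*-Solver
  lemma : ∀ k → (1 ℕ.* suc (double k) ℕ.+ 1 ℕ.* suc (double k)) ℕ.* suc k
              ≡ 1 ℕ.* (suc (double k) ℕ.* suc (double k))
  lemma = solve 1 (λ k →
    (con 1 :* (con 2 :+ (k :+ k)) :+ con 1 :* (con 2 :+ (k :+ k))) :* (con 1 :+ k)
      := con 1 :* ((con 2 :+ (k :+ k)) :* (con 2 :+ (k :+ k)))) refl

infixl 6 _+_
_+_ : ℝ → ℝ → ℝ
x + y = record { seq = f ; regular = regular-from f bound }
  where
  f : ℕ → ℚᵘ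
  f k = seq x (double k) ℚ.+ seq y (double k)

  bound : ∀ m n → f m ≤ᵘ f n ℚ.+ ((1/1+ m) ℚ.+ (1/1+ n))
  bound m n = begin
    f m
      ≤⟨ ℚₚ.+-mono-≤ (regular-≤ x (double m) (double n)) (regular-≤ y (double m) (double n)) ⟩
    (a ℚ.+ (u ℚ.+ v)) ℚ.+ (b ℚ.+ (u ℚ.+ v))
      ≃⟨ solve 4 (λ a b u v → (a :+ (u :+ v)) :+ (b :+ (u :+ v))
                     := (a :+ b) :+ ((u :+ u) :+ (v :+ v))) ℚₚ.≃-refl a b u v ⟩
    f n ℚ.+ ((u ℚ.+ u) ℚ.+ (v ℚ.+ v))
      ≃⟨ ℚₚ.+-congʳ (f n) (ℚₚ.+-cong (halves m) (halves n)) ⟩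
    f n ℚ.+ ((1/1+ m) ℚ.+ (1/1+ n))
      ∎
    where
    open ℚₚ.≤-Reasoning
    open +-*-Solver
    a = seq x (double n)
    b = seq y (double n)
    u = 1/1+ double m
    v = 1/1+ double n

min : ℝ → ℝ → ℝ
min x y = record { seq = f ; regular = regular-from f bound }
  where
  f : ℕ → ℚᵘ
  f k = seq x k ⊓ seq y k

  bound : ∀ m n → f m ≤ᵘ f n ℚ.+ ((1/1+ m) ℚ.+ (1/1+ n))
  bound m n = begin
    f m                                    ≤⟨ ℚₚ.⊓-mono-≤ (regular-≤ x m n) (regular-≤ y m n) ⟩
    (seq x n ℚ.+ c) ⊓ (seq y n ℚ.+ c)      ≃⟨ ℚₚ.≃-sym (ℚₚ.mono-≤-distrib-⊓ (ℚₚ.+-monoˡ-≤ c) (seq x n) (seq y n)) ⟩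
    f n ℚ.+ c                              ∎
    where
    open ℚₚ.≤-Reasoning
    c = (1/1+ m) ℚ.+ (1/1+ n)

2^⌊log₂n⌋≤n : ∀ n .{{_ : NonZero n}} → 2 ^ ⌊log₂ n ⌋ ℕ.≤ n
2^⌊log₂n⌋≤n n = <-rec P step n
  where
  P : ℕ → Set
  P n = .{{_ : NonZero n}} → 2 ^ ⌊log₂ n ⌋ ℕ.≤ n

  2*⌊n/2⌋≤n : ∀ n → 2 ℕ.* ℕ.⌊ n /2⌋ ℕ.≤ n
  2*⌊n/2⌋≤n n = begin
    2 ℕ.* ℕ.⌊ n /2⌋            ≡⟨ cong (ℕ.⌊ n /2⌋ ℕ.+_) (ℕₚ.+-identityʳ _) ⟩
    ℕ.⌊ n /2⌋ ℕ.+ ℕ.⌊ n /2⌋    ≤⟨ ℕₚ.+-monoʳ-≤ ℕ.⌊ n /2⌋ (ℕₚ.⌊n/2⌋≤⌈n/2⌉ n) ⟩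
    ℕ.⌊ n /2⌋ ℕ.+ ℕ.⌈ n /2⌉    ≡⟨ ℕₚ.⌊n/2⌋+⌈n/2⌉≡n n ⟩
    n                          ∎
    where
    open ℕₚ.≤-Reasoning

  step : ∀ n → (∀ {m} → m ℕ.< n → P m) → P n
  step (suc zero) _ = ℕₚ.≤-refl
  step n@(suc (suc k)) rec = begin
    2 ^ ⌊log₂ n ⌋                    ≤⟨ ℕₚ.^-monoʳ-≤ 2 (ℕₚ.m≤n+m∸n ⌊log₂ n ⌋ 1) ⟩
    2 ^ (1 ℕ.+ (⌊log₂ n ⌋ ∸ 1))      ≡⟨ cong (λ l → 2 ^ suc l) (sym (⌊log₂⌊n/2⌋⌋≡⌊log₂n⌋∸1 n)) ⟩
    2 ℕ.* 2 ^ ⌊log₂ ℕ.⌊ n /2⌋ ⌋      ≤⟨ ℕₚ.*-monoʳ-≤ 2 (rec (s≤s (s≤s (ℕₚ.⌊n/2⌋≤n k)))) ⟩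
    2 ℕ.* ℕ.⌊ n /2⌋                  ≤⟨ 2*⌊n/2⌋≤n n ⟩
    n                                ∎
    where
    open ℕₚ.≤-Reasoning

n<2^1+⌊log₂n⌋ : ∀ n → n ℕ.< 2 ^ suc ⌊log₂ n ⌋
n<2^1+⌊log₂n⌋ n = ℕₚ.≰⇒> λ 2^≤n → ℕₚ.1+n≰n
  (subst (ℕ._≤ ⌊log₂ n ⌋) (⌊log₂[2^n]⌋≡n (suc ⌊log₂ n ⌋)) (⌊log₂⌋-mono-≤ 2^≤n))

⌊log₂^⌋-cross : ∀ n .{{_ : NonZero n}} a b →
  ⌊log₂ n ^ a ⌋ ℕ.* b ℕ.≤ suc ⌊log₂ n ^ b ⌋ ℕ.* a
⌊log₂^⌋-cross n a b = ℕₚ.≮⇒≥ λ lt → ℕₚ.<-irrefl refl (begin-strict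
  2 ^ (suc L′ ℕ.* a)   <⟨ ℕₚ.^-monoʳ-< 2 (s≤s (s≤s z≤n)) lt ⟩
  2 ^ (L ℕ.* b)        ≡⟨ sym (ℕₚ.^-*-assoc 2 L b) ⟩
  (2 ^ L) ^ b          ≤⟨ ℕₚ.^-monoˡ-≤ b (2^⌊log₂n⌋≤n (n ^ a)) ⟩
  (n ^ a) ^ b          ≡⟨ ℕₚ.^-*-assoc n a b ⟩
  n ^ (a ℕ.* b)        ≡⟨ cong (n ^_) (ℕₚ.*-comm a b) ⟩
  n ^ (b ℕ.* a)        ≡⟨ sym (ℕₚ.^-*-assoc n b a) ⟩
  (n ^ b) ^ a          ≤⟨ ℕₚ.^-monoˡ-≤ a (ℕₚ.<⇒≤ (n<2^1+⌊log₂n⌋ (n ^ b))) ⟩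
  (2 ^ suc L′) ^ a     ≡⟨ ℕₚ.^-*-assoc 2 (suc L′) a ⟩
  2 ^ (suc L′ ℕ.* a)   ∎)
  where
  open ℕₚ.≤-Reasoning
  instance n^a≢0 = ℕₚ.m^n≢0 n a
  L  = ⌊log₂ n ^ a ⌋
  L′ = ⌊log₂ n ^ b ⌋

cross⇒≤ᵘ : ∀ a b j k → a ℕ.* suc k ℕ.≤ b ℕ.* suc j → mkℚᵘ (+ a) j ≤ᵘ mkℚᵘ (+ b) k
cross⇒≤ᵘ a b j k h = *≤* (subst₂ ℤ._≤_ (ℤₚ.pos-* a (suc k)) (ℤₚ.pos-* b (suc j)) (ℤ.+≤+ h))

suc-over : ∀ l k → mkℚᵘ (+ suc l) k ≃ᵘ mkℚᵘ (+ l) k ℚ.+ (1/1+ k)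
suc-over l k = *≡* (solve 2 (λ l d → (con (+ 1) :+ l) :* (d :* d)
  := (l :* d :+ con (+ 1) :* d) :* d) refl (+ l) (+ suc k))
  where open ℤ-Solver.+-*-Solver

-- For n, k > 0, ⌊log₂ (n^k)⌋ / k ≤ log₂ n < ⌊log₂ (n^k)⌋ / k + 1/k, since
-- log₂ (n^k) = k log₂ n.  The value log₂ 0 = 0 is a dummy.
log₂-approx : ℕ → ℕ → ℚᵘ
log₂-approx n k = mkℚᵘ (+ ⌊log₂ n ^ suc k ⌋) k

log₂ : ℕ → ℝ
log₂ n = record { seq = log₂-approx n ; regular = regular-from (log₂-approx n) (bound n) }
  where
  nonNeg : ∀ p q → ℚ.NonNegative q → p ≤ᵘ p ℚ.+ q
  nonNeg p q h = ℚₚ.p≤p+q p q {{h}}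

  bound : ∀ n j k → log₂-approx n j ≤ᵘ log₂-approx n k ℚ.+ ((1/1+ j) ℚ.+ (1/1+ k))
  bound zero j k = *≤* (ℤ.+≤+ z≤n)
  bound n@(suc _) j k = begin
    log₂-approx n j                       ≤⟨ cross⇒≤ᵘ _ _ j k (⌊log₂^⌋-cross n (suc j) (suc k)) ⟩
    mkℚᵘ (+ suc ⌊log₂ n ^ suc k ⌋) k      ≃⟨ suc-over ⌊log₂ n ^ suc k ⌋ k ⟩
    log₂-approx n k ℚ.+ (1/1+ k)          ≤⟨ nonNeg _ (1/1+ j) _ ⟩
    log₂-approx n k ℚ.+ (1/1+ k) ℚ.+ (1/1+ j)
      ≃⟨ solve 3 (λ a b c → (a :+ b) :+ c := a :+ (c :+ b)) ℚₚ.≃-refl (log₂-approx n k) (1/1+ k) (1/1+ j) ⟩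
    log₂-approx n k ℚ.+ ((1/1+ j) ℚ.+ (1/1+ k)) ∎
    where
    open ℚₚ.≤-Reasoning
    open +-*-Solver

infix 4 _≡_[mod_]
_≡_[mod_] : ℕ → ℕ → ℕ → Set
a ≡ b [mod m ] = m ∣ ℕ.∣ a - b ∣

-- o = ord_m(2)
IsOrder₂ : ℕ → ℕ → Set
IsOrder₂ m o = 0 ℕ.< o × 2 ^ o ≡ 1 [mod m ] ×
  (∀ o′ → 0 ℕ.< o′ → 2 ^ o′ ≡ 1 [mod m ] → o ℕ.≤ o′)

Bit : Set
Bit = Fin 2

-- The polynomial Σ_{n<k} sₙ xⁿ at x; at x = 2 this is the integer with
-- binary digits s, least significant first.
eval : ∀ {k} → Vec Bit k → ℕ → ℕ
eval s x = sum (tabulate λ n → toℕ (lookup s n) ℕ.* x ^ toℕ n)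

BinarySequence : Set
BinarySequence = ℕ → Bit

Periodic : ℕ → BinarySequence → Set
Periodic T S = ∀ n → S (n ℕ.+ T) ≡ S n

initialVector : (T : ℕ) → BinarySequence → Vec Bit T
initialVector T S = tabulate (S ∘ toℕ)

fromInitialVector : ∀ {T} .{{_ : NonZero T}} → Vec Bit T → BinarySequence
fromInitialVector {T} v n = lookup v (n mod T)

reverseSequence : (T : ℕ) .{{_ : NonZero T}} → BinarySequence → BinarySequence
reverseSequence T S = fromInitialVector (reverse (initialVector T S))

module _ (T : ℕ) .{{T≢0 : NonZero T}} where

  2^T∸1≢0 : 2 ^ T ∸ 1 ≢ 0
  2^T∸1≢0 eq = ℕₚ.<⇒≱ (ℕₚ.^-monoʳ-< 2 (s≤s (s≤s z≤n)) (ℕ.>-nonZero⁻¹ T)) (ℕₚ.m∸n≡0⇒m≤n eq)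

  -- The quotient is an integer, so _/_ is exact here.
  complexity : BinarySequence → ℝ
  complexity S = log₂ ((2 ^ T ∸ 1) / gcd (2 ^ T ∸ 1) s)
    where
    s = eval (initialVector T S) 2
    instance _ = ℕ.≢-nonZero (gcd[m,n]≢0 (2 ^ T ∸ 1) s (inj₁ 2^T∸1≢0))

  symComplexity : BinarySequence → ℝ
  symComplexity S = min (complexity S) (complexity (reverseSequence T S))

-- (s₀, …, s_{t-1}, 0, …, 0) of length T.  Truncates for T < t, which
-- cannot happen when a t-bit number q > 1 with top bit 1 divides 2^T - 1.
padTo : ∀ T {t} → Vec Bit t → Vec Bit T
padTo zero    _       = []
padTo (suc T) []      = Fin.zero ∷ padTo T []
padTo (suc T) (b ∷ s) = b ∷ padTo T s

{-# OPTIONS --safe #-}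

-- Since T is not a multiple of ord_p(2), the prime p = S_T(2) is coprime to
-- 2^T - 1, so λ(S) = log₂ (2^T - 1).  The reversed initial vector evaluates to
-- 2^(T-t) q, and q divides the odd number 2^T - 1, so the relevant gcd is q and
-- λ(S^rev) = log₂ ((2^T - 1) / q), which is the smaller of the two.

module Submission where

open import Defs
open import Data.Nat.Base using (ℕ; suc; NonZero; _^_; _∸_; _>_)
open import Data.Nat.Primality using (Prime)
open import Data.Fin.Patterns using (1F)
open import Data.Vec.Base using (Vec; head; last; reverse)
open import Data.Product.Base using (_×_)
open import Relation.Nullary.Negation using (¬_)
open import Relation.Binary.PropositionalEquality using (_≡_; _≢_)

open import Data.Nat.Base as ℕ using (zero; _*_; _≤_; _<_; z≤n; s≤s; >-nonZero)
import Data.Nat.Properties as ℕₚ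
open import Data.Nat.Coprimality using (Coprime; coprime⇒gcd≡1)
open import Data.Nat.Divisibility
open import Data.Nat.DivMod
  using (_/_; _%_; m%n<n; m≡m%n+[m/n]*n; m<n⇒m%n≡m; /-congʳ; n/1≡n; m*n/n≡m)
open import Data.Nat.GCD using (gcd; gcd[m,n]≢0; gcd[m,n]∣m; gcd[m,n]∣n; c*gcd[m,n]≡gcd[cm,cn])
open import Data.Nat.Logarithm using (⌊log₂_⌋; ⌊log₂⌋-mono-≤; ⌊log₂[2^n]⌋≡n)
open import Data.Nat.Primality using (prime⇒irreducible)
import Data.Nat.Solver as ℕ-Solver
open import Data.Integer.Base using (+_)
import Data.Integer.Solver as ℤ-Solver
open import Data.Rational.Unnormalised.Base as ℚ
  using (mkℚᵘ; *≡*) renaming (_≤_ to _≤ᵘ_; _≃_ to _≃ᵘ_)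
import Data.Rational.Unnormalised.Properties as ℚₚ
open import Data.Rational.Unnormalised.Solver using (module +-*-Solver)
open import Data.Fin.Base using (Fin; toℕ)
open import Data.Fin.Properties using (toℕ<n; toℕ-fromℕ<; toℕ-injective)
open import Data.Vec.Base using ([]; _∷_; _∷ʳ_; lookup; tabulate; sum)
open import Data.Vec.Properties using (reverse-∷; tabulate∘lookup; tabulate-cong)
open import Data.Product.Base using (_,_)
open import Data.Sum.Base using (inj₁; inj₂)
open import Function.Base using (_∘_)
open import Relation.Nullary.Negation using (contradiction)
open import Relation.Binary.PropositionalEquality
  using (refl; sym; trans; cong; cong₂; subst; subst₂; module ≡-Reasoning)

-- Additivity of the real logarithm, through integer floors.

⌊log₂⌋-*-lower : ∀ m n .{{_ : NonZero m}} .{{_ : NonZero n}} →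
  ⌊log₂ m ⌋ ℕ.+ ⌊log₂ n ⌋ ≤ ⌊log₂ m * n ⌋
⌊log₂⌋-*-lower m n = subst (_≤ ⌊log₂ m * n ⌋) (⌊log₂[2^n]⌋≡n (⌊log₂ m ⌋ ℕ.+ ⌊log₂ n ⌋))
  (⌊log₂⌋-mono-≤ (begin
    2 ^ (⌊log₂ m ⌋ ℕ.+ ⌊log₂ n ⌋)   ≡⟨ ℕₚ.^-distribˡ-+-* 2 ⌊log₂ m ⌋ ⌊log₂ n ⌋ ⟩
    2 ^ ⌊log₂ m ⌋ * 2 ^ ⌊log₂ n ⌋   ≤⟨ ℕₚ.*-mono-≤ (2^⌊log₂n⌋≤n m) (2^⌊log₂n⌋≤n n) ⟩
    m * n                           ∎))
  where open ℕₚ.≤-Reasoning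

-- If the floor exceeded this bound, `m * n` would be at least 2 to the power
-- `⌊log₂ m ⌋ + ⌊log₂ n ⌋ + 2`. That power is the product of the strict upper bounds on `m` and `n`.
⌊log₂⌋-*-upper : ∀ m n .{{_ : NonZero m}} .{{_ : NonZero n}} →
  ⌊log₂ m * n ⌋ ≤ suc (⌊log₂ m ⌋ ℕ.+ ⌊log₂ n ⌋)
⌊log₂⌋-*-upper m n = ℕₚ.≮⇒≥ λ lt → ℕₚ.<-irrefl refl (begin-strict
  m * n                                      <⟨ ℕₚ.*-mono-< (n<2^1+⌊log₂n⌋ m) (n<2^1+⌊log₂n⌋ n) ⟩
  2 ^ suc ⌊log₂ m ⌋ * 2 ^ suc ⌊log₂ n ⌋      ≡⟨ ℕₚ.^-distribˡ-+-* 2 (suc ⌊log₂ m ⌋) (suc ⌊log₂ n ⌋) ⟨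
  2 ^ (suc ⌊log₂ m ⌋ ℕ.+ suc ⌊log₂ n ⌋)      ≡⟨ cong (λ l → 2 ^ suc l) (ℕₚ.+-suc ⌊log₂ m ⌋ ⌊log₂ n ⌋) ⟩
  2 ^ suc (suc (⌊log₂ m ⌋ ℕ.+ ⌊log₂ n ⌋))    ≤⟨ ℕₚ.^-monoʳ-≤ 2 lt ⟩
  2 ^ ⌊log₂ m * n ⌋                          ≤⟨ 2^⌊log₂n⌋≤n (m * n) ⟩
  m * n                                      ∎)
  where
  open ℕₚ.≤-Reasoning
  instance m*n≢0 = ℕₚ.m*n≢0 m n

*-distribʳ-^ : ∀ m n k → (m * n) ^ k ≡ m ^ k * n ^ k
*-distribʳ-^ m n zero = refl
*-distribʳ-^ m n (suc k) = trans (cong (m * n *_) (*-distribʳ-^ m n k))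
  (solve 4 (λ m n x y → (m :* n) :* (x :* y) := (m :* x) :* (n :* y)) refl m n (m ^ k) (n ^ k))
  where open ℕ-Solver.+-*-Solver

+-over : ∀ a b k → mkℚᵘ (+ (a ℕ.+ b)) k ≃ᵘ mkℚᵘ (+ a) k ℚ.+ mkℚᵘ (+ b) k
+-over a b k = *≡* (solve 3 (λ a b d → (a :+ b) :* (d :* d) := (a :* d :+ b :* d) :* d)
  refl (+ a) (+ b) (+ suc k))
  where open ℤ-Solver.+-*-Solver

over-mono : ∀ {a b} k → a ≤ b → mkℚᵘ (+ a) k ≤ᵘ mkℚᵘ (+ b) k
over-mono {a} {b} k a≤b = cross⇒≤ᵘ a b k k (ℕₚ.*-monoˡ-≤ (suc k) a≤b)

-- Both orientations are returned because the theorem is a chain of two equalities around a common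
-- middle term: once the complexities are evaluated, its two halves are the same equality read in
-- opposite directions.
≈-intro : ∀ x y →
  (∀ n → seq x n ≤ᵘ seq y n ℚ.+ mkℚᵘ (+ 2) n) → (∀ n → seq y n ≤ᵘ seq x n ℚ.+ mkℚᵘ (+ 2) n) →
  (x ≈ y) × (y ≈ x)
≈-intro x y x≤ y≤ =
  (λ n → ∣x-y∣≤b (seq x n) (seq y n) _ (x≤ n) (y≤ n)) ,
  (λ n → ∣x-y∣≤b (seq y n) (seq x n) _ (y≤ n) (x≤ n))

-- Since `n` is positive, the minimum is `log₂ m`, and additivity of the logarithm gives the rest.
-- The minimum is kept in the statement so that `m = k` and `n = q` yield the goal of the theorem
-- directly.
log₂-min-* : ∀ m n .{{_ : NonZero m}} .{{_ : NonZero n}} →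
  (log₂ (m * n) ≈ min (log₂ (m * n)) (log₂ m) + log₂ n) ×
  (min (log₂ (m * n)) (log₂ m) + log₂ n ≈ log₂ (m * n))
log₂-min-* m n = ≈-intro (log₂ (m * n)) (min (log₂ (m * n)) (log₂ m) + log₂ n) upper lower
  where
  open ℚₚ.≤-Reasoning
  A = log₂-approx (m * n)
  B = seq (min (log₂ (m * n)) (log₂ m) + log₂ n)

  module _ (k : ℕ) where
    -- The sum of reals samples its summands at `double k`, so all floors are compared at this
    -- index.
    N = double k
    a = ⌊log₂ m ^ suc N ⌋
    b = ⌊log₂ n ^ suc N ⌋
    c = ⌊log₂ (m * n) ^ suc N ⌋
    u = 1/1+ k
    v = 1/1+ N
    instance
      m^≢0 = ℕₚ.m^n≢0 m (suc N)
      n^≢0 = ℕₚ.m^n≢0 n (suc N)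

    a+b≤c : a ℕ.+ b ≤ c
    a+b≤c = subst (λ z → a ℕ.+ b ≤ ⌊log₂ z ⌋) (sym (*-distribʳ-^ m n (suc N)))
      (⌊log₂⌋-*-lower (m ^ suc N) (n ^ suc N))

    c≤1+a+b : c ≤ suc (a ℕ.+ b)
    c≤1+a+b = subst (λ z → ⌊log₂ z ⌋ ≤ suc (a ℕ.+ b)) (sym (*-distribʳ-^ m n (suc N)))
      (⌊log₂⌋-*-upper (m ^ suc N) (n ^ suc N))

    -- At index `N` all approximations share one denominator, and `a ≤ c` lets the minimum select
    -- `a`.
    B≃ : B k ≃ᵘ mkℚᵘ (+ (a ℕ.+ b)) N
    B≃ = ℚₚ.≃-trans
      (ℚₚ.+-congˡ (log₂-approx n N)
        (ℚₚ.p≥q⇒p⊓q≃q (over-mono N (ℕₚ.≤-trans (ℕₚ.m≤m+n a b) a+b≤c))))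
      (ℚₚ.≃-sym (+-over a b N))

    u+u : u ℚ.+ u ≃ᵘ mkℚᵘ (+ 2) k
    u+u = ℚₚ.≃-sym (+-over 1 1 k)

    v≤u : v ≤ᵘ u
    v≤u = cross⇒≤ᵘ 1 1 N k (ℕₚ.*-monoʳ-≤ 1 (s≤s (ℕₚ.≤-trans (ℕₚ.m≤m+n k k) (ℕₚ.n≤1+n _))))

    -- The error budget is met exactly: moving from index `k` to `N` costs `u + v`, the floors lose
    -- one more `v`, and `v + v = u`, which leaves `u + u`, that is 2/(k+1).
    upper : A k ≤ᵘ B k ℚ.+ mkℚᵘ (+ 2) k
    upper = begin
      A k                                             ≤⟨ regular-≤ (log₂ (m * n)) k N ⟩
      A N ℚ.+ (u ℚ.+ v)                               ≤⟨ ℚₚ.+-monoˡ-≤ (u ℚ.+ v) (over-mono N c≤1+a+b) ⟩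
      mkℚᵘ (+ suc (a ℕ.+ b)) N ℚ.+ (u ℚ.+ v)          ≃⟨ ℚₚ.+-congˡ (u ℚ.+ v) (suc-over (a ℕ.+ b) N) ⟩
      mkℚᵘ (+ (a ℕ.+ b)) N ℚ.+ v ℚ.+ (u ℚ.+ v)        ≃⟨ solve 3 (λ x u v → (x :+ v) :+ (u :+ v) := x :+ (u :+ (v :+ v))) ℚₚ.≃-refl (mkℚᵘ (+ (a ℕ.+ b)) N) u v ⟩
      mkℚᵘ (+ (a ℕ.+ b)) N ℚ.+ (u ℚ.+ (v ℚ.+ v))      ≃⟨ ℚₚ.+-cong (ℚₚ.≃-sym B≃) (ℚₚ.≃-trans (ℚₚ.+-congʳ u (halves k)) u+u) ⟩
      B k ℚ.+ mkℚᵘ (+ 2) k                            ∎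
      where open +-*-Solver

    -- In this direction the floors cost nothing; only the change of index has to be paid for.
    lower : B k ≤ᵘ A k ℚ.+ mkℚᵘ (+ 2) k
    lower = begin
      B k                         ≃⟨ B≃ ⟩
      mkℚᵘ (+ (a ℕ.+ b)) N        ≤⟨ over-mono N a+b≤c ⟩
      A N                         ≤⟨ regular-≤ (log₂ (m * n)) N k ⟩
      A k ℚ.+ (v ℚ.+ u)           ≤⟨ ℚₚ.+-monoʳ-≤ (A k) (ℚₚ.+-monoˡ-≤ u v≤u) ⟩
      A k ℚ.+ (u ℚ.+ u)           ≃⟨ ℚₚ.+-congʳ (A k) u+u ⟩
      A k ℚ.+ mkℚᵘ (+ 2) k        ∎

-- Evaluation of digit vectors under padding and reversal.

sum-tabulate-*ˡ : ∀ {k} c (f : Fin k → ℕ) → sum (tabulate (λ i → c * f i)) ≡ c * sum (tabulate f)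
sum-tabulate-*ˡ {zero}  c f = sym (ℕₚ.*-zeroʳ c)
sum-tabulate-*ˡ {suc k} c f = trans (cong (c * f Fin.zero ℕ.+_) (sum-tabulate-*ˡ c (f ∘ Fin.suc)))
  (sym (ℕₚ.*-distribˡ-+ c (f Fin.zero) _))

eval-∷ : ∀ {k} (b : Bit) (s : Vec Bit k) x → eval (b ∷ s) x ≡ toℕ b ℕ.+ x * eval s x
eval-∷ b s x = cong₂ ℕ._+_ (ℕₚ.*-identityʳ (toℕ b)) (trans
  (cong sum (tabulate-cong λ i →
    solve 3 (λ c x y → c :* (x :* y) := x :* (c :* y)) refl (toℕ (lookup s i)) x (x ^ toℕ i)))
  (sum-tabulate-*ˡ x (λ i → toℕ (lookup s i) * x ^ toℕ i)))
  where open ℕ-Solver.+-*-Solver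

eval-∷ʳ : ∀ {k} (s : Vec Bit k) (b : Bit) x → eval (s ∷ʳ b) x ≡ eval s x ℕ.+ toℕ b * x ^ k
eval-∷ʳ []      b x = ℕₚ.+-identityʳ (toℕ b * 1)
eval-∷ʳ {suc k} (c ∷ s) b x = begin
  eval (c ∷ (s ∷ʳ b)) x                                ≡⟨ eval-∷ c (s ∷ʳ b) x ⟩
  toℕ c ℕ.+ x * eval (s ∷ʳ b) x                        ≡⟨ cong (λ e → toℕ c ℕ.+ x * e) (eval-∷ʳ s b x) ⟩
  toℕ c ℕ.+ x * (eval s x ℕ.+ toℕ b * x ^ k)           ≡⟨ solve 5 (λ c x e b y → c :+ x :* (e :+ b :* y) := (c :+ x :* e) :+ b :* (x :* y)) refl (toℕ c) x (eval s x) (toℕ b) (x ^ k) ⟩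
  toℕ c ℕ.+ x * eval s x ℕ.+ toℕ b * x ^ suc k         ≡⟨ cong (ℕ._+ toℕ b * x ^ suc k) (eval-∷ c s x) ⟨
  eval (c ∷ s) x ℕ.+ toℕ b * x ^ suc k                 ∎
  where
  open ≡-Reasoning
  open ℕ-Solver.+-*-Solver

eval-reverse-∷ : ∀ {k} (b : Bit) (s : Vec Bit k) x →
  eval (reverse (b ∷ s)) x ≡ eval (reverse s) x ℕ.+ toℕ b * x ^ k
eval-reverse-∷ b s x = trans (cong (λ r → eval r x) (reverse-∷ b s)) (eval-∷ʳ (reverse s) b x)

eval-padTo : ∀ T {t} (s : Vec Bit t) x → t ≤ T → eval (padTo T s) x ≡ eval s x
eval-padTo zero    []      x _ = refl
eval-padTo (suc T) []      x _ = begin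
  eval (Fin.zero ∷ padTo T []) x   ≡⟨ eval-∷ Fin.zero (padTo T []) x ⟩
  x * eval (padTo T []) x          ≡⟨ cong (x *_) (eval-padTo T [] x z≤n) ⟩
  x * 0                            ≡⟨ ℕₚ.*-zeroʳ x ⟩
  0                                ∎
  where open ≡-Reasoning
eval-padTo (suc T) (b ∷ s) x (s≤s t≤T) = begin
  eval (b ∷ padTo T s) x              ≡⟨ eval-∷ b (padTo T s) x ⟩
  toℕ b ℕ.+ x * eval (padTo T s) x    ≡⟨ cong (λ e → toℕ b ℕ.+ x * e) (eval-padTo T s x t≤T) ⟩
  toℕ b ℕ.+ x * eval s x              ≡⟨ eval-∷ b s x ⟨
  eval (b ∷ s) x                      ∎
  where open ≡-Reasoning

m^n≡m^[n∸o]*m^o : ∀ m {n o} → o ≤ n → m ^ n ≡ m ^ (n ∸ o) * m ^ o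
m^n≡m^[n∸o]*m^o m {n} {o} o≤n =
  trans (cong (m ^_) (sym (ℕₚ.m∸n+n≡m o≤n))) (ℕₚ.^-distribˡ-+-* m (n ∸ o) o)

-- Reversal turns the `T ∸ t` padding zeros into the lowest-order digits, which shifts the reversed
-- digits of `s` up by as many places.
eval-reverse-padTo : ∀ T {t} (s : Vec Bit t) x → t ≤ T →
  eval (reverse (padTo T s)) x ≡ x ^ (T ∸ t) * eval (reverse s) x
eval-reverse-padTo zero    []      x _ = refl
eval-reverse-padTo (suc T) []      x _ = begin
  eval (reverse (Fin.zero ∷ padTo T [])) x     ≡⟨ eval-reverse-∷ Fin.zero (padTo T []) x ⟩
  eval (reverse (padTo T [])) x ℕ.+ 0          ≡⟨ ℕₚ.+-identityʳ _ ⟩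
  eval (reverse (padTo T [])) x                ≡⟨ eval-reverse-padTo T [] x z≤n ⟩
  x ^ T * 0                                    ≡⟨ ℕₚ.*-zeroʳ (x ^ T) ⟩
  0                                            ≡⟨ ℕₚ.*-zeroʳ (x ^ suc T) ⟨
  x ^ suc T * 0                                ∎
  where open ≡-Reasoning
eval-reverse-padTo (suc T) {suc t} (b ∷ s) x (s≤s t≤T) = begin
  eval (reverse (b ∷ padTo T s)) x
    ≡⟨ eval-reverse-∷ b (padTo T s) x ⟩
  eval (reverse (padTo T s)) x ℕ.+ toℕ b * x ^ T
    -- `suc T ∸ suc t` reduces to `T ∸ t`, so the induction hypothesis and the split of `x ^ T`
    -- produce the same factor `d`.
    ≡⟨ cong₂ (λ e y → e ℕ.+ toℕ b * y) (eval-reverse-padTo T s x t≤T) (m^n≡m^[n∸o]*m^o x t≤T) ⟩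
  d * eval (reverse s) x ℕ.+ toℕ b * (d * x ^ t)
    ≡⟨ solve 4 (λ d e b y → d :* e :+ b :* (d :* y) := d :* (e :+ b :* y)) refl d (eval (reverse s) x) (toℕ b) (x ^ t) ⟩
  d * (eval (reverse s) x ℕ.+ toℕ b * x ^ t)
    ≡⟨ cong (d *_) (eval-reverse-∷ b s x) ⟨
  d * eval (reverse (b ∷ s)) x
    ∎
  where
  open ≡-Reasoning
  open ℕ-Solver.+-*-Solver
  d = x ^ (T ∸ t)

initialVector-fromInitialVector : ∀ T .{{_ : NonZero T}} (v : Vec Bit T) →
  initialVector T (fromInitialVector v) ≡ v
initialVector-fromInitialVector T v = trans
  (tabulate-cong λ i → cong (lookup v) (toℕ-injective
    (trans (toℕ-fromℕ< (m%n<n (toℕ i) T)) (m<n⇒m%n≡m (toℕ<n i)))))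
  (tabulate∘lookup v)

-- Divisors of 2^n - 1 and the order of 2.

2^n≡1+[2^n∸1] : ∀ n → 2 ^ n ≡ suc (2 ^ n ∸ 1)
2^n≡1+[2^n∸1] n = sym (ℕₚ.m+[n∸m]≡n (ℕₚ.m^n>0 2 n))

-- In this form a divisor of `2 ^ n ∸ 1` can be removed from the right-hand side, leaving
-- `2 ^ m ∸ 1`; this is what drives the reduction of exponents modulo the order.
2^[m+n]∸1 : ∀ m n → 2 ^ (m ℕ.+ n) ∸ 1 ≡ 2 ^ m * (2 ^ n ∸ 1) ℕ.+ (2 ^ m ∸ 1)
2^[m+n]∸1 m n = ℕₚ.suc-injective (begin
  suc (2 ^ (m ℕ.+ n) ∸ 1)                       ≡⟨ 2^n≡1+[2^n∸1] (m ℕ.+ n) ⟨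
  2 ^ (m ℕ.+ n)                                 ≡⟨ ℕₚ.^-distribˡ-+-* 2 m n ⟩
  2 ^ m * 2 ^ n                                 ≡⟨ cong (2 ^ m *_) (2^n≡1+[2^n∸1] n) ⟩
  2 ^ m * suc (2 ^ n ∸ 1)                       ≡⟨ ℕₚ.*-suc (2 ^ m) _ ⟩
  2 ^ m ℕ.+ 2 ^ m * (2 ^ n ∸ 1)                 ≡⟨ cong (ℕ._+ 2 ^ m * (2 ^ n ∸ 1)) (2^n≡1+[2^n∸1] m) ⟩
  suc (2 ^ m ∸ 1 ℕ.+ 2 ^ m * (2 ^ n ∸ 1))       ≡⟨ cong suc (ℕₚ.+-comm (2 ^ m ∸ 1) _) ⟩
  suc (2 ^ m * (2 ^ n ∸ 1) ℕ.+ (2 ^ m ∸ 1))     ∎)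
  where open ≡-Reasoning

∣2^n-1∣≡2^n∸1 : ∀ n → ℕ.∣ 2 ^ n - 1 ∣ ≡ 2 ^ n ∸ 1
∣2^n-1∣≡2^n∸1 n = trans (ℕₚ.∣-∣-comm (2 ^ n) 1) (ℕₚ.m≤n⇒∣m-n∣≡n∸m (ℕₚ.m^n>0 2 n))

2^o∸1∣2^[k*o]∸1 : ∀ k o → 2 ^ o ∸ 1 ∣ 2 ^ (k * o) ∸ 1
2^o∸1∣2^[k*o]∸1 zero    o = (2 ^ o ∸ 1) ∣0
2^o∸1∣2^[k*o]∸1 (suc k) o = subst (2 ^ o ∸ 1 ∣_) (sym (2^[m+n]∸1 o (k * o)))
  (∣m∣n⇒∣m+n (∣n⇒∣m*n (2 ^ o) (2^o∸1∣2^[k*o]∸1 k o)) ∣-refl)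

order∣⇒∣2^∸1 : ∀ {m o n} → IsOrder₂ m o → n ≡ 0 [mod o ] → m ∣ 2 ^ n ∸ 1
order∣⇒∣2^∸1 {m} {o} {n} (_ , 2^o≡1 , _) o∣n with subst (o ∣_) (ℕₚ.∣-∣-identityʳ n) o∣n
... | divides k refl = ∣-trans (subst (m ∣_) (∣2^n-1∣≡2^n∸1 o) 2^o≡1) (2^o∸1∣2^[k*o]∸1 k o)

-- Division with remainder: `m` divides `2 ^ (n / o * o) ∸ 1`, hence also `2 ^ (n % o) ∸ 1`. A
-- positive remainder would contradict the minimality of `o`.
∣2^∸1⇒order∣ : ∀ {m o n} → IsOrder₂ m o → m ∣ 2 ^ n ∸ 1 → n ≡ 0 [mod o ]
∣2^∸1⇒order∣ {m} {o} {n} (0<o , 2^o≡1 , least) m∣ =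
  subst (o ∣_) (sym (ℕₚ.∣-∣-identityʳ n)) (m%n≡0⇒n∣m n o (r≡0 (n % o) (m%n<n n o) m∣2^r∸1))
  where
  instance o≢0 = >-nonZero 0<o

  m∣2^r∸1 : m ∣ 2 ^ (n % o) ∸ 1
  m∣2^r∸1 = ∣m+n∣m⇒∣n
    (subst (m ∣_) (trans (cong (λ e → 2 ^ e ∸ 1) (m≡m%n+[m/n]*n n o)) (2^[m+n]∸1 (n % o) (n / o * o))) m∣)
    (∣n⇒∣m*n (2 ^ (n % o)) (∣-trans (subst (m ∣_) (∣2^n-1∣≡2^n∸1 o) 2^o≡1) (2^o∸1∣2^[k*o]∸1 (n / o) o)))

  r≡0 : ∀ r → r < o → m ∣ 2 ^ r ∸ 1 → r ≡ 0
  r≡0 zero    _   _  = refl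
  r≡0 (suc r) r<o m∣ = contradiction
    (least (suc r) (s≤s z≤n) (subst (m ∣_) (sym (∣2^n-1∣≡2^n∸1 (suc r))) m∣))
    (ℕₚ.<⇒≱ r<o)

-- As `d ≤ n`, a common divisor divides both `2 ^ n` and its predecessor, hence 1.
2^n∸1-coprime-2^d : ∀ n {d} → d ≤ n → Coprime (2 ^ n ∸ 1) (2 ^ d)
2^n∸1-coprime-2^d n {d} d≤n {i} (i∣ , i∣2^d) = ∣1⇒≡1 (∣m+n∣m⇒∣n
  (subst (i ∣_) (trans (2^n≡1+[2^n∸1] n) (ℕₚ.+-comm 1 _))
    (∣-trans i∣2^d (subst (2 ^ d ∣_) (sym (m^n≡m^[n∸o]*m^o 2 d≤n)) (n∣m*n (2 ^ (n ∸ d))))))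
  i∣)

prime∤⇒gcd≡1 : ∀ {p n} → Prime p → ¬ p ∣ n → gcd n p ≡ 1
prime∤⇒gcd≡1 {p} {n} pp p∤n with prime⇒irreducible pp (gcd[m,n]∣n n p)
... | inj₁ g≡1 = g≡1
... | inj₂ g≡p = contradiction (subst (_∣ n) g≡p (gcd[m,n]∣m n p)) p∤n

-- The complexities of the sequence and of its reverse.

-- The cofactor `k` is supplied explicitly so that the natural-number quotient in `complexity`
-- evaluates to it without rounding.
complexity-≡ : ∀ T .{{_ : NonZero T}} S k g .{{_ : NonZero g}} → 2 ^ T ∸ 1 ≡ k * g →
  gcd (2 ^ T ∸ 1) (eval (initialVector T S) 2) ≡ g → complexity T S ≡ log₂ k
complexity-≡ T S k g M≡k*g gcd≡g = cong log₂
  (trans (/-congʳ gcd≡g) (trans (cong (_/ g) M≡k*g) (m*n/n≡m k g)))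
  where
  instance gcd≢0 = ℕ.≢-nonZero (gcd[m,n]≢0 (2 ^ T ∸ 1) (eval (initialVector T S) 2) (inj₁ (2^T∸1≢0 T)))

theorem1 : ∀ (p : ℕ) → Prime p → p > 2 →
    ∀ (t-1 : ℕ) (s : Vec Bit (suc t-1)) → head s ≡ 1F → last s ≡ 1F → p ≡ eval s 2 →
    ∀ (q : ℕ) → q ≡ eval (reverse s) 2 → p ≢ q →
    ∀ (ordp ordq : ℕ) → IsOrder₂ p ordp → IsOrder₂ q ordq →
    ∀ (T : ℕ) .{{_ : NonZero T}} → T ≡ 0 [mod ordq ] → ¬ (T ≡ 0 [mod ordp ]) →
    ∀ (S : BinarySequence) → Periodic T S → initialVector T S ≡ padTo T s →
    (complexity T S ≈ symComplexity T S + log₂ q) × (symComplexity T S + log₂ q ≈ log₂ (2 ^ T ∸ 1))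
theorem1 p pp _ t-1 s@(b ∷ s′) refl _ p≡ q q≡ _ ordp ordq ordp-order ordq-order T T≡0 T≢0 S _ S≡ =
  go (order∣⇒∣2^∸1 {n = T} ordq-order T≡0)
  where
  M = 2 ^ T ∸ 1

  -- The digit `head s`, which is 1, becomes the top digit of `q`.
  2^t-1≤q : 2 ^ t-1 ≤ q
  2^t-1≤q = begin
    2 ^ t-1                               ≡⟨ ℕₚ.*-identityˡ (2 ^ t-1) ⟨
    1 * 2 ^ t-1                           ≤⟨ ℕₚ.m≤n+m (1 * 2 ^ t-1) (eval (reverse s′) 2) ⟩
    eval (reverse s′) 2 ℕ.+ 1 * 2 ^ t-1   ≡⟨ eval-reverse-∷ 1F s′ 2 ⟨
    eval (reverse s) 2                    ≡⟨ q≡ ⟨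
    q                                     ∎
    where open ℕₚ.≤-Reasoning

  instance
    M≢0 : NonZero M
    M≢0 = ℕ.≢-nonZero (2^T∸1≢0 T)

    q≢0 : NonZero q
    q≢0 = >-nonZero (ℕₚ.≤-trans (ℕₚ.m^n>0 2 t-1) 2^t-1≤q)

  module _ (q∣M : q ∣ M) where
    k = quotient q∣M

    M≡k*q : M ≡ k * q
    M≡k*q = _∣_.equality q∣M

    instance
      k≢0 : NonZero k
      k≢0 = quotient≢0 q∣M

    -- Otherwise 2^T - 1 < 2^T ≤ 2^(t-1) ≤ q, against `q ∣ M` with `M` positive. Hence `padTo T s`
    -- does not truncate.
    t≤T : suc t-1 ≤ T
    t≤T = ℕₚ.≰⇒> λ T≤t-1 → ℕₚ.<-irrefl refl (begin-strict
      M           <⟨ ℕₚ.≤-reflexive (sym (2^n≡1+[2^n∸1] T)) ⟩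
      2 ^ T       ≤⟨ ℕₚ.^-monoʳ-≤ 2 T≤t-1 ⟩
      2 ^ t-1     ≤⟨ 2^t-1≤q ⟩
      q           ≤⟨ ∣⇒≤ q∣M ⟩
      M           ∎)
      where open ℕₚ.≤-Reasoning

    d = T ∸ suc t-1

    λS≡ : complexity T S ≡ log₂ M
    λS≡ = complexity-≡ T S M 1 (sym (ℕₚ.*-identityʳ M)) (begin
      gcd M (eval (initialVector T S) 2)   ≡⟨ cong (λ v → gcd M (eval v 2)) S≡ ⟩
      gcd M (eval (padTo T s) 2)           ≡⟨ cong (gcd M) (eval-padTo T s 2 t≤T) ⟩
      gcd M (eval s 2)                     ≡⟨ cong (gcd M) p≡ ⟨
      -- If `p` divided `M`, then `T` would be a multiple of `ordp`.
      gcd M p                              ≡⟨ prime∤⇒gcd≡1 pp (T≢0 ∘ ∣2^∸1⇒order∣ {n = T} ordp-order) ⟩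
      1                                    ∎)
      where open ≡-Reasoning

    -- Inherited from `M`, of which `k` is a divisor.
    k-coprime-2^d : Coprime k (2 ^ d)
    k-coprime-2^d (i∣k , i∣2^d) = 2^n∸1-coprime-2^d T (ℕₚ.m∸n≤m T (suc t-1))
      (∣-trans i∣k (quotient-∣ q∣M) , i∣2^d)

    λSrev≡ : complexity T (reverseSequence T S) ≡ log₂ k
    λSrev≡ = complexity-≡ T (reverseSequence T S) k q M≡k*q (begin
      gcd M (eval (initialVector T (reverseSequence T S)) 2)
        ≡⟨ cong (λ v → gcd M (eval v 2)) (initialVector-fromInitialVector T (reverse (initialVector T S))) ⟩
      gcd M (eval (reverse (initialVector T S)) 2)
        ≡⟨ cong (λ v → gcd M (eval (reverse v) 2)) S≡ ⟩
      gcd M (eval (reverse (padTo T s)) 2)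
        ≡⟨ cong (gcd M) (eval-reverse-padTo T s 2 t≤T) ⟩
      gcd M (2 ^ d * eval (reverse s) 2)
        -- Both arguments of the gcd are multiples of `q`; pulling it out leaves the coprime pair
        -- `k` and `2 ^ d`.
        ≡⟨ cong₂ (λ m e → gcd m (2 ^ d * e)) (trans M≡k*q (ℕₚ.*-comm k q)) (sym q≡) ⟩
      gcd (q * k) (2 ^ d * q)
        ≡⟨ cong (gcd (q * k)) (ℕₚ.*-comm (2 ^ d) q) ⟩
      gcd (q * k) (q * 2 ^ d)
        ≡⟨ c*gcd[m,n]≡gcd[cm,cn] q k (2 ^ d) ⟨
      q * gcd k (2 ^ d)
        ≡⟨ cong (q *_) (coprime⇒gcd≡1 k-coprime-2^d) ⟩
      q * 1
        ≡⟨ ℕₚ.*-identityʳ q ⟩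
      q
        ∎)
      where open ≡-Reasoning

    go : (complexity T S ≈ symComplexity T S + log₂ q) × (symComplexity T S + log₂ q ≈ log₂ M)
    -- With both complexities evaluated and `M` written as `k * q`, the goal is an instance of
    -- `log₂-min-*`.
    go = subst₂ (λ x y → (x ≈ min x y + log₂ q) × (min x y + log₂ q ≈ log₂ M)) (sym λS≡) (sym λSrev≡)
      (subst (λ m → (log₂ m ≈ min (log₂ m) (log₂ k) + log₂ q) × (min (log₂ m) (log₂ k) + log₂ q ≈ log₂ m))
        (sym M≡k*q) (log₂-min-* k q))
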